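{- Let $w$ be a word of length $n!$ over $\Sigma_n$. Then $w$ is a universal Lyndon word if and only if every conjugate $w_i$ of $w$ is a Lyndon word with respect to the order $\triangleleft_{w_i}$ it defines, i.e. $w_i$ is strictly lexicographically smaller than each of its proper conjugates when letters are ordered by $\triangleleft_{w_i}$ (first occurrence in $w_i$).
   Context: $\Sigma_n=\{1,\ldots,n\}$. For a word $w=a_1\cdots a_m$ its conjugates are $w_i=a_i\cdots a_m a_1\cdots a_{i-1}$; a proper conjugate is $w_2w_1$ where $w=w_1w_2$ with $w_1,w_2$ nonempty. A total order on the alphabet induces the lexicographic order on words ($u$ is smaller than $v$ if $u$ is a proper prefix of $v$, or $u=zau'$, $v=zbv'$ with letters $a<b$). A word $w$ over $\Sigma_n$ is a Lyndon word if there is a total order on $\Sigma_n$ for which $w$ is strictly lexicographically smaller than each of its proper conjugates. A universal Lyndon word of degree $n$ is a word over $\Sigma_n$ of length $n!$ all of whose conjugates are Lyndon words. For a nonempty word $u$, $\mathrm{alp}(u)$ is the set of letters occurring in $u$, and $\triangleleft_u$ is the relation on $\Sigma_n$ given by $i\triangleleft_u j$ iff $i\in\mathrm{alp}(u)$ and either $j\notin\mathrm{alp}(u)$ or the first occurrence of $i$ in $u$ precedes the first occurrence of $j$ in $u$. All conjugates of $w$ have the same letters, so $\triangleleft_{w_i}$ is a total order on the letters occurring in $w$, which suffices to compare conjugates of $w$ lexicographically. -}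

module Defs where

open import Data.Nat using (ℕ; zero; suc; _<_; _≤_; _!)
open import Data.Fin using (Fin)
open import Data.List using (List; []; _∷_; _++_; take; drop; length)
open import Data.List.Membership.Propositional using (_∈_; _∉_)
open import Data.Product using (Σ; _×_; ∃-syntax; _,_)
open import Data.Sum using (_⊎_)
open import Relation.Binary.PropositionalEquality using (_≡_)
open import Relation.Binary.Structures using (IsStrictTotalOrder)
open import Level using (0ℓ)

-- The alphabet Σ_n = {1,…,n} is represented by Fin n (letter k+1 ↦ k).
Word : ℕ → Set
Word n = List (Fin n)

data Lex {A : Set} (_≺_ : A → A → Set) : List A → List A → Set where
  prefix : ∀ {b v} → Lex _≺_ [] (b ∷ v)
  here   : ∀ {a b u v} → a ≺ b → Lex _≺_ (a ∷ u) (b ∷ v)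
  there  : ∀ {a u v} → Lex _≺_ u v → Lex _≺_ (a ∷ u) (a ∷ v)

-- The conjugate a_{i+1} ⋯ a_m a_1 ⋯ a_i  (i.e. w_{i+1} in the paper's indexing).
rotate : {A : Set} → ℕ → List A → List A
rotate i w = drop i w ++ take i w

SmallerThanProperConjugates : {A : Set} (_≺_ : A → A → Set) → List A → Set
SmallerThanProperConjugates _≺_ w =
  ∀ (w₁ w₂ : List _) → w ≡ w₁ ++ w₂ → 0 < length w₁ → 0 < length w₂ →
  Lex _≺_ w (w₂ ++ w₁)

TotalOrderOn : ℕ → Set₁
TotalOrderOn n = Σ (Fin n → Fin n → Set) λ _≺_ → IsStrictTotalOrder _≡_ _≺_

IsLyndon : ∀ {n} → Word n → Set₁
IsLyndon {n} w = Σ (TotalOrderOn n) λ { (_≺_ , _) → SmallerThanProperConjugates _≺_ w }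

AllConjugates : ∀ {a} {A : Set} → (List A → Set a) → List A → Set a
AllConjugates P w = ∀ i → i < length w → P (rotate i w)

IsUniversalLyndon : (n : ℕ) → Word n → Set₁
IsUniversalLyndon n w = (length w ≡ n !) × AllConjugates IsLyndon w

FirstOccAt : ∀ {n} → Fin n → Word n → ℕ → Set
FirstOccAt a u k = ∃[ u₁ ] ∃[ u₂ ] (u ≡ u₁ ++ a ∷ u₂ × a ∉ u₁ × length u₁ ≡ k)

◁[_] : ∀ {n} → Word n → Fin n → Fin n → Set
◁[ u ] i j = i ∈ u × (j ∉ u ⊎ ∃[ k ] ∃[ l ] (FirstOccAt i u k × FirstOccAt j u l × k < l))

{-# OPTIONS --safe #-}
module Submission where

open import Defs
open import Data.Nat using (ℕ; zero; suc; _+_; _<_; _≤_; s≤s; z≤n; s≤s⁻¹; _!)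
open import Data.Nat.Properties as ℕ using (module ≤-Reasoning)
open import Data.Fin using (Fin; zero; suc; toℕ; fromℕ<; combine; _≟_)
open import Data.Fin.Properties using (toℕ<n; pigeonhole; combine-injective; fromℕ<-injective)
open import Data.Fin.Subset as Subset using (Subset; ∣_∣) renaming (_∈_ to _∈ₛ_)
open import Data.Fin.Subset.Properties using (∣p∣≤n; p⊂q⇒∣p∣<∣q∣)
open import Data.List using (List; []; _∷_; _++_; take; drop; length; allFin)
open import Data.List.Properties using (++-assoc; ++-identityʳ; ++-cancelˡ; take++drop≡id; length-++; ∷-injective; ∷-injectiveˡ)
open import Data.List.Membership.Propositional using (_∈_; _∉_)
open import Data.List.Membership.Propositional.Properties using (∈-++⁺ˡ; ∈-++⁺ʳ; ∈-∃++; ∈-allFin)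
import Data.List.Membership.DecPropositional as DecMembership
open import Data.List.Relation.Unary.All as All using (All; []; _∷_)
open import Data.List.Relation.Unary.Any using (here; there)
open import Data.Product using (_×_; _,_; proj₁; proj₂; ∃-syntax)
open import Data.Sum using (_⊎_; inj₁; inj₂)
open import Data.Empty using (⊥-elim)
open import Data.Vec using (tabulate)
open import Data.Vec.Properties using (lookup⇒[]=; []=⇒lookup; lookup∘tabulate)
open import Function using (_∘_)
open import Relation.Nullary using (¬_; yes; no; does; contradiction)
open import Relation.Nullary.Decidable using (dec-true)
open import Relation.Unary using (Pred; Decidable)
open import Relation.Binary using (Rel; Tri; Trichotomous; tri<; tri≈; tri>)
open import Relation.Binary.Structures using (IsStrictTotalOrder)
open import Relation.Binary.PropositionalEquality
open import Level using (0ℓ)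

-- Each total order makes at most one conjugate of w Lyndon. If w is universal,
-- its n! conjugates therefore use up all n! orders, so the order ≺ of first
-- occurrence in a conjugate u makes some conjugate v Lyndon. Suppose v ≠ u, and
-- let u = z c ⋯ and v = z d ⋯ be the first difference. As d ≺ c, the letter d
-- occurs in z, say z = x d y. Let < be an order making the conjugate
-- d y c ⋯ x Lyndon: comparing it with d y d ⋯ x gives c < d, while comparing
-- it with c ⋯ x d y gives d < c.

private variable
  A : Set
  n : ℕ

-- Lexicographic comparison

module _ {_<₁_ _<₂_ : Rel A 0ℓ} where

  -- The smaller letter at the deciding position belongs to the left word, so the implication is
  -- asked only for letters of `u`. This allows `◁[ u ]` as target, in which only letters of `u` lie
  -- below others.
  Lex-map : ∀ {u v} → All (λ a → ∀ {b} → a <₁ b → a <₂ b) u → Lex _<₁_ u v → Lex _<₂_ u v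
  Lex-map _        prefix     = prefix
  Lex-map (f ∷ _)  (here a<b) = here (f a<b)
  Lex-map (_ ∷ fs) (there l)  = there (Lex-map fs l)

  -- A proper prefix is smaller for every letter relation, so opposite comparisons cannot come from
  -- a prefix. Irreflexivity makes both comparisons be decided at the same position.
  Lex-first-difference : (∀ {a} → ¬ a <₁ a) → (∀ {a} → ¬ a <₂ a) → ∀ {u v} →
    Lex _<₁_ u v → Lex _<₂_ v u →
    ∃[ z ] ∃[ c ] ∃[ d ] ∃[ s ] ∃[ t ]
      (u ≡ z ++ c ∷ s × v ≡ z ++ d ∷ t × c <₁ d × d <₂ c)
  Lex-first-difference _ _ (here c<d) (here d<c) = [] , _ , _ , _ , _ , refl , refl , c<d , d<c
  Lex-first-difference irr₁ _ (here a<a) (there _) = contradiction a<a irr₁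
  Lex-first-difference _ irr₂ (there _) (here a<a) = contradiction a<a irr₂
  Lex-first-difference irr₁ irr₂ (there p) (there q)
    with z , _ , _ , _ , _ , refl , refl , c<d , d<c ← Lex-first-difference irr₁ irr₂ p q
    = _ ∷ z , _ , _ , _ , _ , refl , refl , c<d , d<c

module _ {_≺_ : Rel A 0ℓ} (sto : IsStrictTotalOrder _≡_ _≺_) where
  private module O = IsStrictTotalOrder sto

  Lex-asym : ∀ {u v} → Lex _≺_ u v → ¬ Lex _≺_ v u
  Lex-asym p q
    with _ , _ , _ , _ , _ , _ , _ , c≺d , d≺c ← Lex-first-difference (O.irrefl refl) (O.irrefl refl) p q
    = O.asym c≺d d≺c

  Lex-++⁻ : ∀ z {c d s t} → c ≢ d → Lex _≺_ (z ++ c ∷ s) (z ++ d ∷ t) → c ≺ d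
  Lex-++⁻ [] c≢d (here c≺d) = c≺d
  Lex-++⁻ [] c≢d (there _)  = contradiction refl c≢d
  Lex-++⁻ (_ ∷ z) c≢d (here a≺a) = contradiction a≺a (O.irrefl refl)
  Lex-++⁻ (_ ∷ z) c≢d (there p)  = Lex-++⁻ z c≢d p

-- Conjugates and rotations

-- Either factor may be empty, so every word is conjugate to itself and the relation is an
-- equivalence.
Conjugate : List A → List A → Set
Conjugate u v = ∃[ a ] ∃[ b ] (u ≡ a ++ b × v ≡ b ++ a)

Conjugate-sym : {u v : List A} → Conjugate u v → Conjugate v u
Conjugate-sym (a , b , p , q) = b , a , q , p

Levi : ∀ (a b c d : List A) → a ++ b ≡ c ++ d →
  (∃[ e ] (c ≡ a ++ e × b ≡ e ++ d)) ⊎ (∃[ e ] (a ≡ c ++ e × d ≡ e ++ b))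
Levi []      b c       d eq = inj₁ (c , refl , eq)
Levi (x ∷ a) b []      d eq = inj₂ (x ∷ a , refl , sym eq)
Levi (x ∷ a) b (y ∷ c) d eq with refl , eq′ ← ∷-injective eq | Levi a b c d eq′
... | inj₁ (e , p , q) = inj₁ (e , cong (x ∷_) p , q)
... | inj₂ (e , p , q) = inj₂ (e , cong (x ∷_) p , q)

-- The two cuts of `v` split it into three blocks, and `u` and `w` are cyclic arrangements of the
-- same blocks.
Conjugate-trans : {u v w : List A} → Conjugate u v → Conjugate v w → Conjugate u w
Conjugate-trans (a , b , refl , refl) (c , d , p , refl) with Levi b a c d p
... | inj₁ (e , refl , refl) = e , d ++ b , ++-assoc e d b , sym (++-assoc d b e)
... | inj₂ (e , refl , refl) = a ++ c , e , sym (++-assoc a c e) , ++-assoc e a c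

Conjugate-rotate : ∀ i (w : List A) → Conjugate w (rotate i w)
Conjugate-rotate i w = take i w , drop i w , sym (take++drop≡id i w) , refl

rotate-length-++ : ∀ (a b : List A) → rotate (length a) (a ++ b) ≡ b ++ a
rotate-length-++ a b = cong₂ _++_ (drop-length a) (take-length a)
  where
  drop-length : ∀ a → drop (length a) (a ++ b) ≡ b
  drop-length []      = refl
  drop-length (_ ∷ a) = drop-length a
  take-length : ∀ a → take (length a) (a ++ b) ≡ a
  take-length []      = refl
  take-length (x ∷ a) = cong (x ∷_) (take-length a)

Conjugate⇒rotate : {w v : List A} → 0 < length w → Conjugate w v →
  ∃[ i ] (i < length w × v ≡ rotate i w)
-- Here `length a` equals `length w` and is out of range, so the index is 0.
Conjugate⇒rotate 0<∣w∣ (a , [] , refl , refl) =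
  0 , 0<∣w∣ , sym (trans (++-identityʳ _) (++-identityʳ a))
Conjugate⇒rotate _ (a , b@(_ ∷ b′) , refl , refl) =
  length a , ∣a∣<∣a++b∣ , sym (rotate-length-++ a b)
  where
  ∣a∣<∣a++b∣ : length a < length (a ++ b)
  ∣a∣<∣a++b∣ rewrite length-++ a {b} = ℕ.m<m+n (length a) (s≤s z≤n)

-- Cutting `w` at `i` and `j` gives blocks `a`, `b`, `c`, with `b` nonempty by `i < j` and `c` by
-- `j < length w`. Moving `b` from front to back turns the first rotation into the second.
rotations-split : ∀ {i j} (w : List A) → i < j → j < length w →
  ∃[ a ] ∃[ b ] ∃[ c ] (0 < length b × 0 < length c ×
    rotate i w ≡ (b ++ c) ++ a × rotate j w ≡ c ++ (a ++ b))
rotations-split w i<j j<∣w∣ =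
  let a , b , c , 0<b , 0<c , p , q , r , s = split w i<j j<∣w∣
  in a , b , c , 0<b , 0<c , cong₂ _++_ p q , cong₂ _++_ r s
  where
  split : ∀ {i j} (w : List A) → i < j → j < length w →
    ∃[ a ] ∃[ b ] ∃[ c ] (0 < length b × 0 < length c ×
      drop i w ≡ b ++ c × take i w ≡ a × drop j w ≡ c × take j w ≡ a ++ b)
  split {i = zero} {suc j} w@(x ∷ w′) _ j<∣w∣ =
    [] , take (suc j) w , drop (suc j) w , s≤s z≤n , 0<drop j (s≤s⁻¹ j<∣w∣) ,
    sym (take++drop≡id (suc j) w) , refl , refl , refl
    where
    0<drop : ∀ k {xs : List A} → k < length xs → 0 < length (drop k xs)
    0<drop zero            k<  = k<
    0<drop (suc k) {_ ∷ _} k<  = 0<drop k (s≤s⁻¹ k<)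
  split {i = suc i} {suc j} (x ∷ w) i<j j<∣w∣
    with a , b , c , 0<b , 0<c , p , q , r , s ← split w (s≤s⁻¹ i<j) (s≤s⁻¹ j<∣w∣)
    = x ∷ a , b , c , 0<b , 0<c , p , cong (x ∷_) q , r , cong (x ∷_) s

-- Words smaller than their proper conjugates

smaller-than-conjugate : {_≺_ : Rel A 0ℓ} {u v : List A} →
  SmallerThanProperConjugates _≺_ u → Conjugate u v → u ≡ v ⊎ Lex _≺_ u v
smaller-than-conjugate _ ([] , b , refl , refl) = inj₁ (sym (++-identityʳ b))
smaller-than-conjugate _ (a@(_ ∷ _) , [] , refl , refl) = inj₁ (++-identityʳ a)
smaller-than-conjugate lyn (a@(_ ∷ _) , b@(_ ∷ _) , refl , refl) =
  inj₂ (lyn a b refl (s≤s z≤n) (s≤s z≤n))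

SmallerThanProperConjugates-map : {_<₁_ _<₂_ : Rel A 0ℓ} {u : List A} →
  (∀ {a b} → a ∈ u → a <₁ b → a <₂ b) →
  SmallerThanProperConjugates _<₁_ u → SmallerThanProperConjugates _<₂_ u
SmallerThanProperConjugates-map f lyn w₁ w₂ eq 0<w₁ 0<w₂ =
  Lex-map (All.tabulate λ a∈u → f a∈u) (lyn w₁ w₂ eq 0<w₁ 0<w₂)

-- Each rotation would be strictly smaller than the other. The argument concerns positions, so it
-- also excludes two rotations that are equal as words; this is what lets positions be counted
-- against orders.
rotations-not-both-smallest : {_≺_ : Rel A 0ℓ} → IsStrictTotalOrder _≡_ _≺_ →
  ∀ {i j} (w : List A) → i < j → j < length w →
  SmallerThanProperConjugates _≺_ (rotate i w) →
  ¬ SmallerThanProperConjugates _≺_ (rotate j w)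
rotations-not-both-smallest {_≺_ = _≺_} sto w i<j j<∣w∣ lynᵢ lynⱼ
  with a , b , c , 0<b , 0<c , p , q ← rotations-split w i<j j<∣w∣
  = Lex-asym sto
      (subst₂ (Lex _≺_) p refl (lynᵢ b (c ++ a) (trans p (++-assoc b c a)) 0<b (0<-++ c 0<c)))
      (subst₂ (Lex _≺_) (trans q (sym (++-assoc c a b))) (sym (++-assoc b c a))
        (lynⱼ (c ++ a) b (trans q (sym (++-assoc c a b))) (0<-++ c 0<c) 0<b))
  where
  0<-++ : ∀ (xs : List _) {ys} → 0 < length xs → 0 < length (xs ++ ys)
  0<-++ (_ ∷ _) _ = s≤s z≤n

-- The Lehmer code of a total order

subset : {P : Pred (Fin n) 0ℓ} → Decidable P → Subset n
subset P? = tabulate (does ∘ P?)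

module _ {P : Pred (Fin n) 0ℓ} (P? : Decidable P) where

  ∈-subset⁺ : ∀ {x} → P x → x ∈ₛ subset P?
  ∈-subset⁺ {x} px =
    lookup⇒[]= x _ (trans (lookup∘tabulate (does ∘ P?) x) (dec-true (P? x) px))

  ∈-subset⁻ : ∀ {x} → x ∈ₛ subset P? → P x
  ∈-subset⁻ {x} x∈ with P? x in eq
  ... | yes px = px
  ... | no  _
    with () ← trans (sym ([]=⇒lookup x∈)) (trans (lookup∘tabulate (does ∘ P?) x) (cong does eq))

suc-order : {_≺_ : Rel (Fin (suc n)) 0ℓ} → IsStrictTotalOrder _≡_ _≺_ →
  IsStrictTotalOrder _≡_ (λ x y → suc x ≺ suc y)
suc-order {_≺_ = _≺_} sto = record
  { isStrictPartialOrder = record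
    { isEquivalence = isEquivalence
    ; irrefl        = λ { refl → O.irrefl refl }
    ; trans         = O.trans
    ; <-resp-≈      = (λ { refl → λ p → p }) , (λ { refl → λ p → p })
    }
  ; compare = λ x y → compare′ (O.compare (suc x) (suc y))
  }
  where
  module O = IsStrictTotalOrder sto
  compare′ : ∀ {x y} → Tri (suc x ≺ suc y) (suc x ≡ suc y) (suc y ≺ suc x) →
             Tri (suc x ≺ suc y) (x ≡ y) (suc y ≺ suc x)
  compare′ (tri< p q r)    = tri< p (q ∘ cong suc) r
  compare′ (tri≈ p refl r) = tri≈ p refl r
  compare′ (tri> p q r)    = tri> p (q ∘ cong suc) r

below-zero : {_≺_ : Rel (Fin (suc n)) 0ℓ} → IsStrictTotalOrder _≡_ _≺_ → Subset n
below-zero sto = subset λ x → suc x <? zero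
  where open IsStrictTotalOrder sto

module _ {_≺_ : Rel (Fin (suc n)) 0ℓ} (sto : IsStrictTotalOrder _≡_ _≺_) where
  open IsStrictTotalOrder sto using (_<?_)

  ∈-below-zero⁺ : ∀ {x} → suc x ≺ zero → x ∈ₛ below-zero sto
  ∈-below-zero⁺ = ∈-subset⁺ (λ x → suc x <? zero)

  ∈-below-zero⁻ : ∀ {x} → x ∈ₛ below-zero sto → suc x ≺ zero
  ∈-below-zero⁻ = ∈-subset⁻ (λ x → suc x <? zero)

-- The leading digit counts the letters below `zero` and takes `suc n` values; the other digits
-- encode the order of the nonzero letters. The digits fit since `suc n !` unfolds to a product with
-- factors `suc n` and `n !`.
code : {_≺_ : Rel (Fin n) 0ℓ} → IsStrictTotalOrder _≡_ _≺_ → Fin (n !)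
code {zero}  sto = zero
code {suc n} sto = combine (fromℕ< (s≤s (∣p∣≤n (below-zero sto)))) (code (suc-order sto))

-- Both sets of elements below zero are initial segments of the same order on
-- the nonzero elements, so if they have the same size they coincide.
below-zero-⊆ : {_<₁_ _<₂_ : Rel (Fin (suc n)) 0ℓ}
  (o₁ : IsStrictTotalOrder _≡_ _<₁_) (o₂ : IsStrictTotalOrder _≡_ _<₂_) →
  (∀ {x y} → suc x <₂ suc y → suc x <₁ suc y) →
  ∣ below-zero o₁ ∣ ≡ ∣ below-zero o₂ ∣ →
  ∀ {x} → suc x <₁ zero → suc x <₂ zero
below-zero-⊆ o₁ o₂ 2⇒1 ∣p∣≡∣q∣ {x} x<₁0 with IsStrictTotalOrder._<?_ o₂ (suc x) zero
... | yes x<₂0 = x<₂0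
... | no  x≮₂0 = contradiction (sym ∣p∣≡∣q∣)
  (ℕ.<⇒≢ (p⊂q⇒∣p∣<∣q∣ (q⊆p , x , ∈-below-zero⁺ o₁ x<₁0 , x≮₂0 ∘ ∈-below-zero⁻ o₂)))
  where
  module O₁ = IsStrictTotalOrder o₁
  module O₂ = IsStrictTotalOrder o₂
  q⊆p : below-zero o₂ Subset.⊆ below-zero o₁
  q⊆p {y} y∈q with O₂.compare (suc x) (suc y)
  ... | tri< x<y _ _   = contradiction (O₂.trans x<y (∈-below-zero⁻ o₂ y∈q)) x≮₂0
  ... | tri≈ _ refl _  = contradiction (∈-below-zero⁻ o₂ y∈q) x≮₂0
  ... | tri> _ _ y<x   = ∈-below-zero⁺ o₁ (O₁.trans (2⇒1 y<x) x<₁0)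

-- Equal lower digits make the orders agree on nonzero letters, by induction; equal leading digits
-- then put `zero` in the same place.
code-injective : {_<₁_ _<₂_ : Rel (Fin n) 0ℓ}
  (o₁ : IsStrictTotalOrder _≡_ _<₁_) (o₂ : IsStrictTotalOrder _≡_ _<₂_) →
  code o₁ ≡ code o₂ → ∀ {x y} → x <₁ y → x <₂ y
code-injective {suc n} {_<₁_} {_<₂_} o₁ o₂ eq = go _ _
  where
  module O₁ = IsStrictTotalOrder o₁
  module O₂ = IsStrictTotalOrder o₂
  parts = combine-injective (fromℕ< (s≤s (∣p∣≤n (below-zero o₁)))) (code (suc-order o₁))
                            (fromℕ< (s≤s (∣p∣≤n (below-zero o₂)))) (code (suc-order o₂)) eq
  ∣p∣≡∣q∣ : ∣ below-zero o₁ ∣ ≡ ∣ below-zero o₂ ∣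
  ∣p∣≡∣q∣ = fromℕ<-injective _ _ _ _ (proj₁ parts)
  1⇒2 : ∀ {x y} → suc x <₁ suc y → suc x <₂ suc y
  1⇒2 = code-injective (suc-order o₁) (suc-order o₂) (proj₂ parts)
  2⇒1 : ∀ {x y} → suc x <₂ suc y → suc x <₁ suc y
  2⇒1 = code-injective (suc-order o₂) (suc-order o₁) (sym (proj₂ parts))
  go : ∀ x y → x <₁ y → x <₂ y
  go zero    zero    p = contradiction p (O₁.irrefl refl)
  go (suc x) (suc y) p = 1⇒2 p
  go (suc x) zero    p = below-zero-⊆ o₁ o₂ 2⇒1 ∣p∣≡∣q∣ p
  -- By contraposition: `suc y <₂ zero` would transfer back to the first order.
  go zero    (suc y) p with O₂.compare zero (suc y)
  ... | tri< q _ _ = q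
  ... | tri> _ _ q = contradiction (below-zero-⊆ o₂ o₁ 1⇒2 (sym ∣p∣≡∣q∣) q) (O₁.asym p)

-- Pigeonhole on the orders

-- The given order and one order for each rotation make `suc (length w)` orders with only `n !`
-- codes. Two rotations cannot share a code, so the collision involves the given order, placed at
-- index `zero`.
universal⇒every-order : (w : Word n) → length w ≡ n ! → AllConjugates IsLyndon w →
  {_≺_ : Rel (Fin n) 0ℓ} → IsStrictTotalOrder _≡_ _≺_ →
  ∃[ v ] (Conjugate w v × SmallerThanProperConjugates _≺_ v)
universal⇒every-order {n} w ∣w∣≡n! univ {_≺_} sto =
  find (pigeonhole (ℕ.≤-reflexive (cong suc (sym ∣w∣≡n!))) f)
  where
  order-of : (i : Fin (length w)) → IsLyndon (rotate (toℕ i) w)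
  order-of i = univ (toℕ i) (toℕ<n i)
  f : Fin (suc (length w)) → Fin (n !)
  f zero    = code sto
  f (suc i) = code (proj₂ (proj₁ (order-of i)))
  find : ∃[ i ] ∃[ j ] (toℕ i < toℕ j × f i ≡ f j) →
    ∃[ v ] (Conjugate w v × SmallerThanProperConjugates _≺_ v)
  find (zero , suc j , _ , eq) with order-of j
  ... | (_ , o) , lyn =
    rotate (toℕ j) w , Conjugate-rotate (toℕ j) w ,
    SmallerThanProperConjugates-map (λ _ → code-injective o sto (sym eq)) lyn
  find (suc i , suc j , i<j , eq) with order-of i | order-of j
  ... | (_ , oᵢ) , lynᵢ | (_ , oⱼ) , lynⱼ =
    ⊥-elim (rotations-not-both-smallest oⱼ w (s≤s⁻¹ i<j) (toℕ<n j)
      (SmallerThanProperConjugates-map (λ _ → code-injective oᵢ oⱼ eq) lynᵢ) lynⱼ)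

-- The order of first occurrence

module _ {n : ℕ} where
  open DecMembership (_≟_ {n}) using (_∈?_)

  -- Equal to length w if a does not occur in w.
  firstIndex : Fin n → Word n → ℕ
  firstIndex a [] = 0
  firstIndex a (x ∷ w) with a ≟ x
  ... | yes _ = 0
  ... | no  _ = suc (firstIndex a w)

  firstIndex-∈-++ : ∀ {a u} v → a ∈ u → firstIndex a (u ++ v) ≡ firstIndex a u
  firstIndex-∈-++ {a} {x ∷ u} v a∈ with a ≟ x | a∈
  ... | yes _   | _          = refl
  ... | no  a≢x | here a≡x   = contradiction a≡x a≢x
  ... | no  _   | there a∈u  = cong suc (firstIndex-∈-++ v a∈u)

  firstIndex-∉-++ : ∀ {a u} v → a ∉ u → firstIndex a (u ++ v) ≡ length u + firstIndex a v
  firstIndex-∉-++ {a} {[]}    v a∉ = refl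
  firstIndex-∉-++ {a} {x ∷ u} v a∉ with a ≟ x
  ... | yes a≡x = contradiction (here a≡x) a∉
  ... | no  _   = cong suc (firstIndex-∉-++ v (a∉ ∘ there))

  firstIndex-self : ∀ a w → firstIndex a (a ∷ w) ≡ 0
  firstIndex-self a w with a ≟ a
  ... | yes _   = refl
  ... | no  a≢a = contradiction refl a≢a

  firstIndex-++-∷ : ∀ {a} u v → firstIndex a (u ++ a ∷ v) ≤ length u
  firstIndex-++-∷ {a} []      v = ℕ.≤-reflexive (firstIndex-self a v)
  firstIndex-++-∷ {a} (x ∷ u) v with a ≟ x
  ... | yes _ = z≤n
  ... | no  _ = s≤s (firstIndex-++-∷ u v)

  firstIndex<length : ∀ {a u} → a ∈ u → firstIndex a u < length u
  firstIndex<length {a} {x ∷ u} a∈ with a ≟ x | a∈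
  ... | yes _   | _         = s≤s z≤n
  ... | no  a≢x | here a≡x  = contradiction a≡x a≢x
  ... | no  _   | there a∈u = s≤s (firstIndex<length a∈u)

  firstIndex<length⇒∈ : ∀ {a} u v → firstIndex a (u ++ v) < length u → a ∈ u
  firstIndex<length⇒∈ {a} u v lt with a ∈? u
  ... | yes a∈u = a∈u
  ... | no  a∉u = contradiction
    (subst (_< length u) (firstIndex-∉-++ v a∉u) lt) (ℕ.m+n≮m (length u) _)

  -- Only absent letters have index `length w`, so `a ∈ w` excludes the one value that different
  -- letters can share.
  firstIndex-injective : ∀ {a b w} → a ∈ w → firstIndex a w ≡ firstIndex b w → a ≡ b
  firstIndex-injective {a} {b} {x ∷ w} a∈ eq with a ≟ x | b ≟ x | a∈
  ... | yes a≡x | yes b≡x | _         = trans a≡x (sym b≡x)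
  ... | no  a≢x | no _    | here a≡x  = contradiction a≡x a≢x
  ... | no  _   | no _    | there a∈w = firstIndex-injective a∈w (ℕ.suc-injective eq)

  FirstOccAt⇒firstIndex : ∀ {a u k} → FirstOccAt a u k → firstIndex a u ≡ k
  FirstOccAt⇒firstIndex {a} (u₁ , u₂ , refl , a∉u₁ , refl) = begin
    firstIndex a (u₁ ++ a ∷ u₂)         ≡⟨ firstIndex-∉-++ (a ∷ u₂) a∉u₁ ⟩
    length u₁ + firstIndex a (a ∷ u₂)   ≡⟨ cong (length u₁ +_) (firstIndex-self a u₂) ⟩
    length u₁ + 0                       ≡⟨ ℕ.+-identityʳ _ ⟩
    length u₁                           ∎
    where open ≡-Reasoning

  firstOccAt-firstIndex : ∀ {a u} → a ∈ u → FirstOccAt a u (firstIndex a u)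
  firstOccAt-firstIndex {a} {x ∷ u} a∈ with a ≟ x | a∈
  ... | yes refl | _         = [] , u , refl , (λ ()) , refl
  ... | no  a≢x  | here a≡x  = contradiction a≡x a≢x
  ... | no  a≢x  | there a∈u
    with u₁ , u₂ , p , a∉u₁ , q ← firstOccAt-firstIndex a∈u
    = x ∷ u₁ , u₂ , cong (x ∷_) p , (λ { (here a≡x) → a≢x a≡x ; (there a∈u₁) → a∉u₁ a∈u₁ }) , cong suc q

  -- Appending the whole alphabet turns ◁[ u ] into a total order even when
  -- some letters do not occur in u.
  _<[_]_ : Fin n → Word n → Fin n → Set
  a <[ u ] b = firstIndex a (u ++ allFin n) < firstIndex b (u ++ allFin n)

  <[]-isStrictTotalOrder : ∀ u → IsStrictTotalOrder _≡_ (_<[ u ]_)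
  <[]-isStrictTotalOrder u = record
    { isStrictPartialOrder = record
      { isEquivalence = isEquivalence
      ; irrefl        = λ { refl → ℕ.<-irrefl refl }
      ; trans         = ℕ.<-trans
      ; <-resp-≈      = (λ { refl → λ p → p }) , (λ { refl → λ p → p })
      }
    ; compare = cmp
    }
    where
    cmp : Trichotomous _≡_ (_<[ u ]_)
    cmp a b with ℕ.<-cmp (firstIndex a (u ++ allFin n)) (firstIndex b (u ++ allFin n))
    ... | tri< p q r = tri< p (λ { refl → q refl }) r
    ... | tri≈ p q r = tri≈ p (firstIndex-injective (∈-++⁺ʳ u (∈-allFin a)) q) r
    ... | tri> p q r = tri> p (λ { refl → q refl }) r

  ◁⇒<[] : ∀ {u a b} → ◁[ u ] a b → a <[ u ] b
  ◁⇒<[] {u} {a} {b} (a∈u , inj₁ b∉u) = begin-strict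
    firstIndex a (u ++ allFin n)        ≡⟨ firstIndex-∈-++ _ a∈u ⟩
    firstIndex a u                      <⟨ firstIndex<length a∈u ⟩
    length u                            ≤⟨ ℕ.m≤m+n _ _ ⟩
    length u + firstIndex b (allFin n)  ≡⟨ firstIndex-∉-++ _ b∉u ⟨
    firstIndex b (u ++ allFin n)        ∎
    where open ≤-Reasoning
  ◁⇒<[] {u} {a} {b} (a∈u , inj₂ (k , l , occ-a , occ-b@(u₁ , u₂ , refl , _) , k<l)) = begin-strict
    firstIndex a (u ++ allFin n)  ≡⟨ firstIndex-∈-++ _ a∈u ⟩
    firstIndex a u                ≡⟨ FirstOccAt⇒firstIndex occ-a ⟩
    k                             <⟨ k<l ⟩
    l                             ≡⟨ FirstOccAt⇒firstIndex occ-b ⟨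
    firstIndex b u                ≡⟨ firstIndex-∈-++ _ (∈-++⁺ʳ u₁ (here refl)) ⟨
    firstIndex b (u ++ allFin n)  ∎
    where open ≤-Reasoning

  -- Letters absent from `u` are compared with each other by `_<[ u ]_` but not by `◁[ u ]`, hence
  -- the restriction on `a`.
  <[]⇒◁ : ∀ {u a b} → a ∈ u → a <[ u ] b → ◁[ u ] a b
  <[]⇒◁ {u} {a} {b} a∈u a<b with b ∈? u
  ... | no  b∉u = a∈u , inj₁ b∉u
  ... | yes b∈u = a∈u , inj₂ (_ , _ , firstOccAt-firstIndex a∈u , firstOccAt-firstIndex b∈u ,
    subst₂ _<_ (firstIndex-∈-++ _ a∈u) (firstIndex-∈-++ _ b∈u) a<b)

  -- The letter `c` occurs at position `length z` at the latest, so the first `d` comes strictly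
  -- before that, inside `z`.
  <[]-++-∷ : ∀ z {c d s} → d <[ z ++ c ∷ s ] c → d ∈ z
  <[]-++-∷ z {c} {d} {s} d<c = firstIndex<length⇒∈ z (c ∷ s ++ allFin n)
    (subst (λ l → firstIndex d l < length z) (++-assoc z (c ∷ s) (allFin n))
      (ℕ.<-≤-trans d<c
        (subst (λ l → firstIndex c l ≤ length z) (sym (++-assoc z (c ∷ s) (allFin n)))
          (firstIndex-++-∷ z (s ++ allFin n)))))

-- Repeated factors and the equivalence

no-smaller-repetition : {w : Word n} → (∀ {v} → Conjugate w v → IsLyndon v) →
  ∀ x y {c d s t} → c ≢ d →
  Conjugate w ((x ++ d ∷ y) ++ c ∷ s) → ¬ Conjugate w ((x ++ d ∷ y) ++ d ∷ t)
no-smaller-repetition {w = w} lyndon x y {c} {d} {s} {t} c≢d w~u w~v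
  = O.asym c≺d d≺c
  where
  -- Moving `x` to the end makes both words start with `d ∷ y`, and they still first differ right
  -- after it.
  rotate-to-d : ∀ e r → Conjugate ((x ++ d ∷ y) ++ e ∷ r) (d ∷ y ++ e ∷ (r ++ x))
  rotate-to-d e r = x , d ∷ y ++ e ∷ r , ++-assoc x (d ∷ y) (e ∷ r) ,
    sym (++-assoc (d ∷ y) (e ∷ r) x)

  w~u′ : Conjugate w (d ∷ y ++ c ∷ (s ++ x))
  w~u′ = Conjugate-trans w~u (rotate-to-d c s)

  w~v′ : Conjugate w (d ∷ y ++ d ∷ (t ++ x))
  w~v′ = Conjugate-trans w~v (rotate-to-d d t)

  u′-lyndon = lyndon w~u′
  _≺_ = proj₁ (proj₁ u′-lyndon)
  sto : IsStrictTotalOrder _≡_ _≺_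
  sto = proj₂ (proj₁ u′-lyndon)
  module O = IsStrictTotalOrder sto

  c≺d : c ≺ d
  c≺d with smaller-than-conjugate (proj₂ u′-lyndon) (Conjugate-trans (Conjugate-sym w~u′) w~v′)
  ... | inj₁ eq = contradiction (∷-injectiveˡ (++-cancelˡ (d ∷ y) _ _ eq)) c≢d
  ... | inj₂ lt = Lex-++⁻ sto (d ∷ y) c≢d lt

  -- Cutting just before `c` gives a proper conjugate that starts with `c`, so the first letters
  -- decide.
  d≺c : d ≺ c
  d≺c = Lex-++⁻ sto [] (c≢d ∘ sym)
    (proj₂ u′-lyndon (d ∷ y) (c ∷ (s ++ x)) refl (s≤s z≤n) (s≤s z≤n))

theorem1 : (n : ℕ) (w : Word n) → length w ≡ n ! →
    (IsUniversalLyndon n w → ∀ i → i < length w → SmallerThanProperConjugates ◁[ rotate i w ] (rotate i w))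
    × ((∀ i → i < length w → SmallerThanProperConjugates ◁[ rotate i w ] (rotate i w)) → IsUniversalLyndon n w)
theorem1 n w ∣w∣≡n! = to , from
  where
  from : (∀ i → i < length w → SmallerThanProperConjugates ◁[ rotate i w ] (rotate i w)) → IsUniversalLyndon n w
  from lyn = ∣w∣≡n! , λ i i<∣w∣ →
    (_<[ rotate i w ]_ , <[]-isStrictTotalOrder (rotate i w)) ,
    SmallerThanProperConjugates-map (λ _ → ◁⇒<[]) (lyn i i<∣w∣)

  to : IsUniversalLyndon n w → ∀ i → i < length w → SmallerThanProperConjugates ◁[ rotate i w ] (rotate i w)
  to (_ , univ) i i<∣w∣ =
    SmallerThanProperConjugates-map <[]⇒◁ (u-smallest (universal⇒every-order w ∣w∣≡n! univ <ᵤ-order))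
    where
    u = rotate i w
    <ᵤ-order = <[]-isStrictTotalOrder u
    w~u = Conjugate-rotate i w

    lyndon : ∀ {v} → Conjugate w v → IsLyndon v
    lyndon w~v with j , j<∣w∣ , refl ← Conjugate⇒rotate (ℕ.≤-<-trans z≤n i<∣w∣) w~v = univ j j<∣w∣

    u-smallest : ∃[ v ] (Conjugate w v × SmallerThanProperConjugates (_<[ u ]_) v) →
      SmallerThanProperConjugates (_<[ u ]_) u
    u-smallest (v , w~v , v-smallest)
      with (_≺_ , ≺-order) , u-lyndon ← univ i i<∣w∣
      -- Two minimalities meet: that of `v` for `_<[ u ]_` and that of `u` for its own Lyndon order
      -- `_≺_`. Unless the words coincide, the comparisons are opposite.
      with smaller-than-conjugate v-smallest (Conjugate-trans (Conjugate-sym w~v) w~u)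
         | smaller-than-conjugate u-lyndon (Conjugate-trans (Conjugate-sym w~u) w~v)
    ... | inj₁ refl | _         = v-smallest
    ... | inj₂ _    | inj₁ refl = v-smallest
    ... | inj₂ v<u  | inj₂ u≺v
      with z , c , d , s , t , u≡ , refl , c≺d , d<c ← Lex-first-difference
             (IsStrictTotalOrder.irrefl ≺-order refl) (IsStrictTotalOrder.irrefl <ᵤ-order refl) u≺v v<u
      -- As `d` precedes `c` in `u`, it already occurs in `z`, which is split at this occurrence.
      with x , y , refl ← ∈-∃++ (<[]-++-∷ z (subst (λ l → d <[ l ] c) u≡ d<c))
      = ⊥-elim (no-smaller-repetition lyndon x y
          (λ { refl → IsStrictTotalOrder.irrefl ≺-order refl c≺d })
          (subst (Conjugate w) u≡ w~u) w~v)
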